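{- Let $\mathcal A$ be a class of function algebras. Then $\mathcal A\mathsf{RA}_2$ is a lifted extension of $\mathcal A\mathsf{RA}_1$; that is, for every sentence $\varphi$ of $L_1(X,\vec f)$ such that $\mathcal A\mathsf{RA}_1\vdash\varphi$ we have $\mathcal A\mathsf{RA}_2\vdash\varphi{\uparrow}$.
   Context: **Language $L_1$ and BASIC.** $L_1$ is the first-order language with constant $0$, unary function symbols $S,H,T$, binary function symbols $+,\cdot$, a binary pairing function symbol $(\cdot,\cdot)$, and a binary relation $<$. Write $1=S(0)$, $2=S(S(0))$, and $x\le y$ for $x<y\lor x=y$. Pairing associates to the right, and $f(x,y)$ means $f((x,y))$. BASIC consists of the universal closures of: $S(x)\neq 0$; $S(x)=S(y)\to x=y$; $x+0=x$; $x+S(y)=S(x+y)$; $x\cdot 0=0$; $x\cdot S(y)=x\cdot y+x$; $\lnot x<0$; $x<S(y)\leftrightarrow x<y\lor x=y$; $x<y\lor x=y\lor y<x$; $0<x\to\exists y<x\,S(y)=x$; $(x,y)=z\leftrightarrow 2\cdot z=(x+y)\cdot(x+y+1)+2\cdot x+2$; $(x,y)=(x',y')\to x=x'\land y=y'$; $z>0\to\exists x,y<z\,(x,y)=z$; $H((x,y))=x$; $H(0)=0$; $T((x,y))=y$; $T(0)=0$. **$L_2$ and functions as sets.** $L_2$ is the two-sorted language extending $L_1$ with set variables and atomic formulas $t\in X$. $L_1(X,\vec f)$ is $L_1$ with additional unary predicate symbols ("set constants") $X$ and $f_d$ ($d$ a derivation, below). For a set $f$, $f\in\mathcal F$ abbreviates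 $\forall x\exists y\,(x,y)\in f\land\forall x,y,y'((x,y)\in f\land(x,y')\in f\to y=y')\land 0\notin f$; $f(t)=s$ abbreviates $(t,s)\in f$. **Function operators and classes of algebras.** A function operator $f:=\mathrm{op}(g_1,\dots,g_n)$ ($n\ge 0$) is specified by a formula of $L_2$ with no free number variables and no set quantifiers, containing exactly the set variables $f,g_1,\dots,g_n$, such that for all $X\subseteq\mathbb N$ and $g_1,\dots,g_n\subseteq\mathbb N$ in $\mathcal F$ there is a unique $f\subseteq\mathbb N$ satisfying $f:=\mathrm{op}(g_1,\dots,g_n)$ and $f\in\mathcal F$. The oracle operator $f:=X_\ast$ is $\forall x((x\in X\to f(x)=1)\land(x\notin X\to f(x)=0))$. A class of function algebras $\mathcal A$ is given by a finite tuple of function operators; it is required throughout that this tuple contains the following operators, each the universal closure of the displayed formula: - $f:=\mathrm S$: $f(x)=S(x)$; - $f:=\oplus$: $f(x,y)=x+y\land f(0)=0$; - $f:=\otimes$: $f(x,y)=x\cdot y\land f(0)=0$; - $f:={<_\ast}$: $(x<y\to f(x,y)=1)\land(x\ge y\to f(x,y)=0)\land f(0)=0$; - $f:=\mathrm I$: $f(x)=x$; - $f:=\mathrm D$: $f(0,y,z)=y\land f(S(x),y,z)=z\land f(0)=0\land f(x,0)=0$; - $f:=\mathrm P(g,h)$: $g(x)=v\land h(x)=w\to f(x)=(v,w)$; - $f:=g\circ h$: $h(x)=z\land g(z)=y\to f(x)=y$; - $f:=\mu(g)$: $(f(b,x)=z\to z\le b)\land(f(b,x)=z\land y<b\land g(y,x)=1\to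 z\le y)\land(f(b,x)=z\land z<b\to g(z,x)=1)\land f(0)=0$. **Derivations and $\mathcal A\mathsf{RA}_1$.** Derivations in $\mathcal A$ are the least set of formal terms containing the symbol $X_\ast$ and containing $\mathrm{op}(d_1,\dots,d_n)$ for each $n$-ary operator $\mathrm{op}$ of $\mathcal A$ and derivations $d_1,\dots,d_n$. They are enumerated in a fixed sequence in which $\mathrm{op}(d_1,\dots,d_n)$ is preceded by $d_1,\dots,d_n$, and are identified with their indices in $\mathbb N$; so $\vec f=f_0,f_1,\dots$. $\mathcal A\mathsf{RA}_1$ is the theory in $L_1(X,\vec f)$ consisting of BASIC, the axioms $f_{X_\ast}:=X_\ast$ and $f_{X_\ast}\in\mathcal F$, and for each operator and derivations $d_1,\dots,d_n$ the axioms $f_{\mathrm{op}(d_1,\dots,d_n)}:=\mathrm{op}(f_{d_1},\dots,f_{d_n})$ and $f_{\mathrm{op}(d_1,\dots,d_n)}\in\mathcal F$. **$\mathcal A\mathsf{RA}_2$.** The $L_2$-theory axiomatized by BASIC; for each operator $\mathrm{op}$ of $\mathcal A$, $\forall g_1,\dots,g_n\in\mathcal F\,\exists f\in\mathcal F\;f:=\mathrm{op}(g_1,\dots,g_n)$; the oracle axiom $\forall X\exists f\in\mathcal F\;f:=X_\ast$; and function comprehension $\forall p\,\forall f\in\mathcal F\,\exists X\,\forall x(x\in X\leftrightarrow f(x,p)=1)$. **Lifting.** For $k\in\mathbb N$ let $\Phi_k$ be the set of axioms of $\mathcal A\mathsf{RA}_1$ defining the constants $f_0,\dots,f_{k-1}$,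 i.e. for each $d<k$ the oracle axiom or operator axiom for $f_d$, together with $f_d\in\mathcal F$. For a sentence $\varphi$ of $L_1(X,\vec f)$ let $k=d+1$ for the largest $d$ such that $f_d$ occurs in $\varphi$, and $k=0$ if there is none. Treating the set constants $X,f_0,\dots,f_{k-1}$ as set variables, the lifted form $\varphi{\uparrow}$ is the $L_2$-sentence $\forall X\,\forall f_0\cdots\forall f_{k-1}\bigl(\bigwedge\Phi_k\to\varphi\bigr)$. -}

module Defs where

open import Axiom.ExcludedMiddle using (ExcludedMiddle)
open import Data.Empty using () renaming (⊥ to Empty)
open import Data.Fin using (Fin; zero; suc)
import Data.Fin as Fin
open import Data.List using (List; []; _∷_; _++_; [_]; map; foldr; concatMap; upTo; allFin)
open import Data.List.Relation.Unary.All using (All)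
open import Data.List.Membership.Propositional using () renaming (_∈_ to _∈ˡ_)
open import Data.Nat using (ℕ; zero; suc; _⊔_)
import Data.Nat as ℕ
open import Data.Product using (Σ; ∃; ∃-syntax; _×_; _,_; proj₁; proj₂)
open import Data.Sum using (_⊎_)
open import Data.Vec using (Vec; lookup)
import Data.Vec.Functional as F
open import Function using (_∘_; id; _↔_; Inverse)
open import Level using (0ℓ)
open import Relation.Binary.PropositionalEquality using (_≡_)
open import Relation.Nullary using (yes; no)
open import Relation.Unary using (Pred; _≐_)

------------------------------------------------------------------------
-- Terms and formulas

data Term (n : ℕ) : Set where
  var       : Fin n → Term n
  𝟎         : Term n
  S H T     : Term n → Term n
  _+_ _·_   : Term n → Term n → Term n
  ⟨_,_⟩     : Term n → Term n → Term n

infixl 8 _·_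
infixl 7 _+_

𝟏 𝟐 : ∀ {n} → Term n
𝟏 = S 𝟎
𝟐 = S 𝟏

pattern v₀ = var zero
pattern v₁ = var (suc zero)
pattern v₂ = var (suc (suc zero))
pattern v₃ = var (suc (suc (suc zero)))

-- The set constants X, f₀, f₁, … of L₁(X, f⃗).
data Constant : Set where
  X : Constant
  f : ℕ → Constant

-- What may stand to the right of ∈: the set constants, or s set variables
-- in scope (de Bruijn indices).
data SetScope : Set where
  constants : SetScope
  vars      : ℕ → SetScope

SetSymbol : SetScope → Set
SetSymbol constants = Constant
SetSymbol (vars s)  = Fin s

data Kind : Set where
  arithmetical second-order : Kind

-- Formula arithmetical constants n : formulas of L₁(X, f⃗);
-- Formula arithmetical (vars s) n  : formulas of L₂ without set quantifiers;
-- Formula second-order (vars s) n  : formulas of L₂;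
-- each with free number variables among n (and free set variables among s).
data Formula : Kind → SetScope → ℕ → Set where
  _≈_ _<_     : ∀ {κ 𝓢 n} → Term n → Term n → Formula κ 𝓢 n
  _∈_         : ∀ {κ 𝓢 n} → Term n → SetSymbol 𝓢 → Formula κ 𝓢 n
  ⊥           : ∀ {κ 𝓢 n} → Formula κ 𝓢 n
  _∧_ _∨_ _⇒_ : ∀ {κ 𝓢 n} → Formula κ 𝓢 n → Formula κ 𝓢 n → Formula κ 𝓢 n
  ∀₁_ ∃₁_     : ∀ {κ 𝓢 n} → Formula κ 𝓢 (suc n) → Formula κ 𝓢 n
  ∀₂_ ∃₂_     : ∀ {s n} → Formula second-order (vars (suc s)) n →
                Formula second-order (vars s) n

infix  6 _≈_ _<_ _≤_ _∈_ _∉_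
infix  5 ¬_ ∀₁_ ∃₁_ ∀₂_ ∃₂_
infixr 4 _∧_
infixr 3 _∨_
infixr 2 _⇒_
infix  1 _⇔_

private
  variable
    κ : Kind
    𝓢 𝓢′ : SetScope
    m n s s′ : ℕ

¬_ : Formula κ 𝓢 n → Formula κ 𝓢 n
¬ φ = φ ⇒ ⊥

_⇔_ : Formula κ 𝓢 n → Formula κ 𝓢 n → Formula κ 𝓢 n
φ ⇔ ψ = (φ ⇒ ψ) ∧ (ψ ⇒ φ)

_≤_ : Term n → Term n → Formula κ 𝓢 n
t ≤ u = t < u ∨ t ≈ u

_∉_ : Term n → SetSymbol 𝓢 → Formula κ 𝓢 n
t ∉ Y = ¬ (t ∈ Y)

⋀ : List (Formula κ 𝓢 n) → Formula κ 𝓢 n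
⋀ = foldr _∧_ (¬ ⊥)

closure : ∀ n → Formula κ 𝓢 n → Formula κ 𝓢 0
closure zero    φ = φ
closure (suc n) φ = closure n (∀₁ φ)

closure₂ : ∀ s → Formula second-order (vars s) n → Formula second-order (vars 0) n
closure₂ zero    φ = φ
closure₂ (suc s) φ = closure₂ s (∀₂ φ)

------------------------------------------------------------------------
-- Substitution of terms for number variables

subᵗ : (Fin m → Term n) → Term m → Term n
subᵗ σ (var i)   = σ i
subᵗ σ 𝟎         = 𝟎
subᵗ σ (S t)     = S (subᵗ σ t)
subᵗ σ (H t)     = H (subᵗ σ t)
subᵗ σ (T t)     = T (subᵗ σ t)
subᵗ σ (t + u)   = subᵗ σ t + subᵗ σ u
subᵗ σ (t · u)   = subᵗ σ t · subᵗ σ u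
subᵗ σ ⟨ t , u ⟩ = ⟨ subᵗ σ t , subᵗ σ u ⟩

wkᵗ : Term n → Term (suc n)
wkᵗ = subᵗ (var ∘ suc)

lift₁ : (Fin m → Term n) → Fin (suc m) → Term (suc n)
lift₁ σ = v₀ F.∷ (wkᵗ ∘ σ)

sub₁ : (Fin m → Term n) → Formula κ 𝓢 m → Formula κ 𝓢 n
sub₁ σ (t ≈ u) = subᵗ σ t ≈ subᵗ σ u
sub₁ σ (t < u) = subᵗ σ t < subᵗ σ u
sub₁ σ (t ∈ Y) = subᵗ σ t ∈ Y
sub₁ σ ⊥       = ⊥
sub₁ σ (φ ∧ ψ) = sub₁ σ φ ∧ sub₁ σ ψ
sub₁ σ (φ ∨ ψ) = sub₁ σ φ ∨ sub₁ σ ψ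
sub₁ σ (φ ⇒ ψ) = sub₁ σ φ ⇒ sub₁ σ ψ
sub₁ σ (∀₁ φ)  = ∀₁ sub₁ (lift₁ σ) φ
sub₁ σ (∃₁ φ)  = ∃₁ sub₁ (lift₁ σ) φ
sub₁ σ (∀₂ φ)  = ∀₂ sub₁ σ φ
sub₁ σ (∃₂ φ)  = ∃₂ sub₁ σ φ

wk₁ : Formula κ 𝓢 n → Formula κ 𝓢 (suc n)
wk₁ = sub₁ (var ∘ suc)

_[_]₁ : Formula κ 𝓢 (suc n) → Term n → Formula κ 𝓢 n
φ [ t ]₁ = sub₁ (t F.∷ var) φ

infix 9 _[_]₁ _[_]₂

------------------------------------------------------------------------
-- Substitution of set variables and set constants

sub₂ : (Fin s → Fin s′) → Formula second-order (vars s) n →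
       Formula second-order (vars s′) n
sub₂ τ (t ≈ u) = t ≈ u
sub₂ τ (t < u) = t < u
sub₂ τ (t ∈ Y) = t ∈ τ Y
sub₂ τ ⊥       = ⊥
sub₂ τ (φ ∧ ψ) = sub₂ τ φ ∧ sub₂ τ ψ
sub₂ τ (φ ∨ ψ) = sub₂ τ φ ∨ sub₂ τ ψ
sub₂ τ (φ ⇒ ψ) = sub₂ τ φ ⇒ sub₂ τ ψ
sub₂ τ (∀₁ φ)  = ∀₁ sub₂ τ φ
sub₂ τ (∃₁ φ)  = ∃₁ sub₂ τ φ
sub₂ τ (∀₂ φ)  = ∀₂ sub₂ (Fin.lift 1 τ) φ
sub₂ τ (∃₂ φ)  = ∃₂ sub₂ (Fin.lift 1 τ) φ

wk₂ : Formula second-order (vars s) n → Formula second-order (vars (suc s)) n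
wk₂ = sub₂ suc

_[_]₂ : Formula second-order (vars (suc s)) n → Fin s → Formula second-order (vars s) n
φ [ Y ]₂ = sub₂ (Y F.∷ id) φ

-- Reads an arithmetical formula over another supply of set symbols,
-- possibly as a formula of L₂.
interpret : (SetSymbol 𝓢 → SetSymbol 𝓢′) → Formula arithmetical 𝓢 n → Formula κ 𝓢′ n
interpret τ (t ≈ u) = t ≈ u
interpret τ (t < u) = t < u
interpret τ (t ∈ Y) = t ∈ τ Y
interpret τ ⊥       = ⊥
interpret τ (φ ∧ ψ) = interpret τ φ ∧ interpret τ ψ
interpret τ (φ ∨ ψ) = interpret τ φ ∨ interpret τ ψ
interpret τ (φ ⇒ ψ) = interpret τ φ ⇒ interpret τ ψ
interpret τ (∀₁ φ)  = ∀₁ interpret τ φ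
interpret τ (∃₁ φ)  = ∃₁ interpret τ φ

------------------------------------------------------------------------
-- Classical natural deduction: one-sorted for arithmetical formulas,
-- two-sorted (without equality of sets) for second-order ones

infix 0 _⊢_ _⊩_

data _⊢_ : List (Formula κ 𝓢 n) → Formula κ 𝓢 n → Set where
  hyp : {Γ : List (Formula κ 𝓢 n)} {φ : Formula κ 𝓢 n} → φ ∈ˡ Γ → Γ ⊢ φ
  raa : {Γ : List (Formula κ 𝓢 n)} {φ : Formula κ 𝓢 n} → (¬ φ) ∷ Γ ⊢ ⊥ → Γ ⊢ φ
  ⇒I  : {Γ : List (Formula κ 𝓢 n)} {φ ψ : Formula κ 𝓢 n} → φ ∷ Γ ⊢ ψ → Γ ⊢ φ ⇒ ψ
  ⇒E  : {Γ : List (Formula κ 𝓢 n)} {φ ψ : Formula κ 𝓢 n} → Γ ⊢ φ ⇒ ψ → Γ ⊢ φ → Γ ⊢ ψ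
  ∧I  : {Γ : List (Formula κ 𝓢 n)} {φ ψ : Formula κ 𝓢 n} → Γ ⊢ φ → Γ ⊢ ψ → Γ ⊢ φ ∧ ψ
  ∧E₁ : {Γ : List (Formula κ 𝓢 n)} {φ ψ : Formula κ 𝓢 n} → Γ ⊢ φ ∧ ψ → Γ ⊢ φ
  ∧E₂ : {Γ : List (Formula κ 𝓢 n)} {φ ψ : Formula κ 𝓢 n} → Γ ⊢ φ ∧ ψ → Γ ⊢ ψ
  ∨I₁ : {Γ : List (Formula κ 𝓢 n)} {φ ψ : Formula κ 𝓢 n} → Γ ⊢ φ → Γ ⊢ φ ∨ ψ
  ∨I₂ : {Γ : List (Formula κ 𝓢 n)} {φ ψ : Formula κ 𝓢 n} → Γ ⊢ ψ → Γ ⊢ φ ∨ ψ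
  ∨E  : {Γ : List (Formula κ 𝓢 n)} {φ ψ χ : Formula κ 𝓢 n} →
        Γ ⊢ φ ∨ ψ → φ ∷ Γ ⊢ χ → ψ ∷ Γ ⊢ χ → Γ ⊢ χ
  ≈I  : {Γ : List (Formula κ 𝓢 n)} (t : Term n) → Γ ⊢ t ≈ t
  ≈E  : {Γ : List (Formula κ 𝓢 n)} (φ : Formula κ 𝓢 (suc n)) {t u : Term n} →
        Γ ⊢ t ≈ u → Γ ⊢ φ [ t ]₁ → Γ ⊢ φ [ u ]₁
  ∀₁I : {Γ : List (Formula κ 𝓢 n)} {φ : Formula κ 𝓢 (suc n)} → map wk₁ Γ ⊢ φ → Γ ⊢ ∀₁ φ
  ∀₁E : {Γ : List (Formula κ 𝓢 n)} {φ : Formula κ 𝓢 (suc n)} →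
        Γ ⊢ ∀₁ φ → (t : Term n) → Γ ⊢ φ [ t ]₁
  ∃₁I : {Γ : List (Formula κ 𝓢 n)} (φ : Formula κ 𝓢 (suc n)) (t : Term n) →
        Γ ⊢ φ [ t ]₁ → Γ ⊢ ∃₁ φ
  ∃₁E : {Γ : List (Formula κ 𝓢 n)} {φ : Formula κ 𝓢 (suc n)} {ψ : Formula κ 𝓢 n} →
        Γ ⊢ ∃₁ φ → φ ∷ map wk₁ Γ ⊢ wk₁ ψ → Γ ⊢ ψ
  ∀₂I : {Γ : List (Formula second-order (vars s) n)} {φ : Formula second-order (vars (suc s)) n} →
        map wk₂ Γ ⊢ φ → Γ ⊢ ∀₂ φ
  ∀₂E : {Γ : List (Formula second-order (vars s) n)} {φ : Formula second-order (vars (suc s)) n} →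
        Γ ⊢ ∀₂ φ → (Y : Fin s) → Γ ⊢ φ [ Y ]₂
  ∃₂I : {Γ : List (Formula second-order (vars s) n)} (φ : Formula second-order (vars (suc s)) n)
        (Y : Fin s) → Γ ⊢ φ [ Y ]₂ → Γ ⊢ ∃₂ φ
  ∃₂E : {Γ : List (Formula second-order (vars s) n)} {φ : Formula second-order (vars (suc s)) n}
        {ψ : Formula second-order (vars s) n} →
        Γ ⊢ ∃₂ φ → φ ∷ map wk₂ Γ ⊢ wk₂ ψ → Γ ⊢ ψ
  -- L₂ has no closed set terms, so that the set sort is nonempty (as always
  -- in first-order logic) is not a consequence of the rules above.
  inhabited₂ : {Γ : List (Formula second-order (vars s) n)} {φ : Formula second-order (vars s) n} →
        map wk₂ Γ ⊢ wk₂ φ → Γ ⊢ φ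

Theory : Kind → SetScope → Set₁
Theory κ 𝓢 = Pred (Formula κ 𝓢 0) 0ℓ

_⊩_ : Theory κ 𝓢 → Formula κ 𝓢 0 → Set
𝓣 ⊩ φ = ∃[ Γ ] All 𝓣 Γ × (Γ ⊢ φ)

------------------------------------------------------------------------
-- BASIC

∃₁<_∙_ : Term n → Formula κ 𝓢 (suc n) → Formula κ 𝓢 n
∃₁< t ∙ φ = ∃₁ (v₀ < wkᵗ t ∧ φ)

BASIC : List (Formula κ 𝓢 0)
BASIC =
    closure 1 (¬ (S v₀ ≈ 𝟎))
  ∷ closure 2 (S v₀ ≈ S v₁ ⇒ v₀ ≈ v₁)
  ∷ closure 1 (v₀ + 𝟎 ≈ v₀)
  ∷ closure 2 (v₀ + S v₁ ≈ S (v₀ + v₁))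
  ∷ closure 1 (v₀ · 𝟎 ≈ 𝟎)
  ∷ closure 2 (v₀ · S v₁ ≈ v₀ · v₁ + v₀)
  ∷ closure 1 (¬ (v₀ < 𝟎))
  ∷ closure 2 (v₀ < S v₁ ⇔ v₀ < v₁ ∨ v₀ ≈ v₁)
  ∷ closure 2 (v₀ < v₁ ∨ v₀ ≈ v₁ ∨ v₁ < v₀)
  ∷ closure 1 (𝟎 < v₀ ⇒ (∃₁< v₀ ∙ (S v₀ ≈ v₁)))
  ∷ closure 3 (⟨ v₀ , v₁ ⟩ ≈ v₂ ⇔ 𝟐 · v₂ ≈ (v₀ + v₁) · (v₀ + v₁ + 𝟏) + 𝟐 · v₀ + 𝟐)
  ∷ closure 4 (⟨ v₀ , v₁ ⟩ ≈ ⟨ v₂ , v₃ ⟩ ⇒ v₀ ≈ v₂ ∧ v₁ ≈ v₃)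
  ∷ closure 1 (𝟎 < v₀ ⇒ (∃₁< v₀ ∙ (∃₁< v₁ ∙ (⟨ v₁ , v₀ ⟩ ≈ v₂))))
  ∷ closure 2 (H ⟨ v₀ , v₁ ⟩ ≈ v₀)
  ∷ H 𝟎 ≈ 𝟎
  ∷ closure 2 (T ⟨ v₀ , v₁ ⟩ ≈ v₁)
  ∷ T 𝟎 ≈ 𝟎
  ∷ []

------------------------------------------------------------------------
-- Functions as sets

_⟨_⟩≈_ : SetSymbol 𝓢 → Term n → Term n → Formula κ 𝓢 n
g ⟨ t ⟩≈ u = ⟨ t , u ⟩ ∈ g

infix 6 _⟨_⟩≈_

_∈𝓕 : SetSymbol 𝓢 → Formula κ 𝓢 n
g ∈𝓕 = (∀₁ ∃₁ (⟨ v₁ , v₀ ⟩ ∈ g))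
     ∧ (∀₁ ∀₁ ∀₁ (⟨ v₂ , v₁ ⟩ ∈ g ∧ ⟨ v₂ , v₀ ⟩ ∈ g ⇒ v₁ ≈ v₀))
     ∧ 𝟎 ∉ g

------------------------------------------------------------------------
-- The standard model

-- 2z = (x + y)(x + y + 1) + 2x + 2
pairℕ : ℕ → ℕ → ℕ
pairℕ x y = ((x ℕ.+ y) ℕ.* (x ℕ.+ y ℕ.+ 1) ℕ.+ 2 ℕ.* x ℕ.+ 2) ℕ./ 2

-- Walks along the diagonals: unpairℕ n is the n-th pair, whose code is suc n.
unpairℕ : ℕ → ℕ × ℕ
unpairℕ zero    = 0 , 0
unpairℕ (suc n) = next (unpairℕ n)
  where
  next : ℕ × ℕ → ℕ × ℕ
  next (x , zero)  = 0 , suc x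
  next (x , suc y) = suc x , y

headℕ tailℕ : ℕ → ℕ
headℕ zero    = 0
headℕ (suc n) = proj₁ (unpairℕ n)
tailℕ zero    = 0
tailℕ (suc n) = proj₂ (unpairℕ n)

⟦_⟧ᵗ : Term n → (Fin n → ℕ) → ℕ
⟦ var i ⟧ᵗ     ρ = ρ i
⟦ 𝟎 ⟧ᵗ         ρ = 0
⟦ S t ⟧ᵗ       ρ = suc (⟦ t ⟧ᵗ ρ)
⟦ H t ⟧ᵗ       ρ = headℕ (⟦ t ⟧ᵗ ρ)
⟦ T t ⟧ᵗ       ρ = tailℕ (⟦ t ⟧ᵗ ρ)
⟦ t + u ⟧ᵗ     ρ = ⟦ t ⟧ᵗ ρ ℕ.+ ⟦ u ⟧ᵗ ρ
⟦ t · u ⟧ᵗ     ρ = ⟦ t ⟧ᵗ ρ ℕ.* ⟦ u ⟧ᵗ ρ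
⟦ ⟨ t , u ⟩ ⟧ᵗ ρ = pairℕ (⟦ t ⟧ᵗ ρ) (⟦ u ⟧ᵗ ρ)

⟦_⟧ : Formula arithmetical 𝓢 n → (SetSymbol 𝓢 → Pred ℕ 0ℓ) → (Fin n → ℕ) → Set
⟦ t ≈ u ⟧ η ρ = ⟦ t ⟧ᵗ ρ ≡ ⟦ u ⟧ᵗ ρ
⟦ t < u ⟧ η ρ = ⟦ t ⟧ᵗ ρ ℕ.< ⟦ u ⟧ᵗ ρ
⟦ t ∈ Y ⟧ η ρ = η Y (⟦ t ⟧ᵗ ρ)
⟦ ⊥ ⟧     η ρ = Empty
⟦ φ ∧ ψ ⟧ η ρ = ⟦ φ ⟧ η ρ × ⟦ ψ ⟧ η ρ
⟦ φ ∨ ψ ⟧ η ρ = ⟦ φ ⟧ η ρ ⊎ ⟦ ψ ⟧ η ρ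
⟦ φ ⇒ ψ ⟧ η ρ = ⟦ φ ⟧ η ρ → ⟦ ψ ⟧ η ρ
⟦ ∀₁ φ ⟧  η ρ = ∀ a → ⟦ φ ⟧ η (a F.∷ ρ)
⟦ ∃₁ φ ⟧  η ρ = ∃[ a ] ⟦ φ ⟧ η (a F.∷ ρ)

_⊨_ : (Fin s → Pred ℕ 0ℓ) → Formula arithmetical (vars s) 0 → Set
η ⊨ φ = ⟦ φ ⟧ η F.[]

------------------------------------------------------------------------
-- Function operators and classes of function algebras

setSymbols : Formula arithmetical 𝓢 n → List (SetSymbol 𝓢)
setSymbols (t ≈ u) = []
setSymbols (t < u) = []
setSymbols (t ∈ Y) = [ Y ]
setSymbols ⊥       = []
setSymbols (φ ∧ ψ) = setSymbols φ ++ setSymbols ψ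
setSymbols (φ ∨ ψ) = setSymbols φ ++ setSymbols ψ
setSymbols (φ ⇒ ψ) = setSymbols φ ++ setSymbols ψ
setSymbols (∀₁ φ)  = setSymbols φ
setSymbols (∃₁ φ)  = setSymbols φ

-- The formula f := op(g₁, …, gₙ); the set variable zero is f and suc j is
-- the j-th argument.
OperatorFormula : ℕ → Set
OperatorFormula n = Formula arithmetical (vars (suc n)) 0

-- The metatheory of function operators is classical: without excluded middle,
-- the existence of f would demand that f be computable from g₁, …, gₙ, which
-- rules out operators such as number quantification.
DefinesFunction : OperatorFormula n → Set₁
DefinesFunction {n} φ =
  ExcludedMiddle 0ℓ →
  (g : Fin n → Pred ℕ 0ℓ) → (∀ j → g ⊨ (j ∈𝓕)) →
  Σ (Pred ℕ 0ℓ) λ h →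
    (h F.∷ g) ⊨ (φ ∧ zero ∈𝓕) ×
    (∀ h′ → (h′ F.∷ g) ⊨ (φ ∧ zero ∈𝓕) → h′ ≐ h)

record FunctionOperator : Set₁ where
  field
    arity           : ℕ
    formula         : OperatorFormula arity
    allOccur        : ∀ Y → Y ∈ˡ setSymbols formula
    definesFunction : DefinesFunction formula

oracleFormula : OperatorFormula 1
oracleFormula = closure 1
  ((v₀ ∈ suc zero ⇒ zero ⟨ v₀ ⟩≈ 𝟏) ∧ (v₀ ∉ suc zero ⇒ zero ⟨ v₀ ⟩≈ 𝟎))

successorFormula additionFormula multiplicationFormula lessThanFormula
  identityFormula caseFormula : OperatorFormula 0

successorFormula = closure 1 (zero ⟨ v₀ ⟩≈ S v₀)

additionFormula = closure 2
  (zero ⟨ ⟨ v₀ , v₁ ⟩ ⟩≈ (v₀ + v₁) ∧ zero ⟨ 𝟎 ⟩≈ 𝟎)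

multiplicationFormula = closure 2
  (zero ⟨ ⟨ v₀ , v₁ ⟩ ⟩≈ (v₀ · v₁) ∧ zero ⟨ 𝟎 ⟩≈ 𝟎)

lessThanFormula = closure 2
  ( (v₀ < v₁ ⇒ zero ⟨ ⟨ v₀ , v₁ ⟩ ⟩≈ 𝟏)
  ∧ (v₁ ≤ v₀ ⇒ zero ⟨ ⟨ v₀ , v₁ ⟩ ⟩≈ 𝟎)
  ∧ zero ⟨ 𝟎 ⟩≈ 𝟎)

identityFormula = closure 1 (zero ⟨ v₀ ⟩≈ v₀)

caseFormula = closure 3
  ( zero ⟨ ⟨ 𝟎 , ⟨ v₁ , v₂ ⟩ ⟩ ⟩≈ v₁
  ∧ zero ⟨ ⟨ S v₀ , ⟨ v₁ , v₂ ⟩ ⟩ ⟩≈ v₂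
  ∧ zero ⟨ 𝟎 ⟩≈ 𝟎
  ∧ zero ⟨ ⟨ v₀ , 𝟎 ⟩ ⟩≈ 𝟎)

pairingFormula compositionFormula : OperatorFormula 2

-- v₀, v₁, v₂ are x, v, w
pairingFormula = closure 3
  (suc zero ⟨ v₀ ⟩≈ v₁ ∧ suc (suc zero) ⟨ v₀ ⟩≈ v₂ ⇒ zero ⟨ v₀ ⟩≈ ⟨ v₁ , v₂ ⟩)

-- v₀, v₁, v₂ are x, y, z
compositionFormula = closure 3
  (suc (suc zero) ⟨ v₀ ⟩≈ v₂ ∧ suc zero ⟨ v₂ ⟩≈ v₁ ⇒ zero ⟨ v₀ ⟩≈ v₁)

minimizationFormula : OperatorFormula 1

-- v₀, v₁, v₂, v₃ are b, x, y, z
minimizationFormula = closure 4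
  ( (zero ⟨ ⟨ v₀ , v₁ ⟩ ⟩≈ v₃ ⇒ v₃ ≤ v₀)
  ∧ (zero ⟨ ⟨ v₀ , v₁ ⟩ ⟩≈ v₃ ∧ v₂ < v₀ ∧ suc zero ⟨ ⟨ v₂ , v₁ ⟩ ⟩≈ 𝟏 ⇒ v₃ ≤ v₂)
  ∧ (zero ⟨ ⟨ v₀ , v₁ ⟩ ⟩≈ v₃ ∧ v₃ < v₀ ⇒ suc zero ⟨ ⟨ v₃ , v₁ ⟩ ⟩≈ 𝟏)
  ∧ zero ⟨ 𝟎 ⟩≈ 𝟎)

requiredFormulas : List (Σ ℕ OperatorFormula)
requiredFormulas =
    (0 , successorFormula)
  ∷ (0 , additionFormula)
  ∷ (0 , multiplicationFormula)
  ∷ (0 , lessThanFormula)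
  ∷ (0 , identityFormula)
  ∷ (0 , caseFormula)
  ∷ (2 , pairingFormula)
  ∷ (2 , compositionFormula)
  ∷ (1 , minimizationFormula)
  ∷ []

record AlgebraClass : Set₁ where
  field
    size     : ℕ
    operator : Fin size → FunctionOperator

  arity : Fin size → ℕ
  arity i = FunctionOperator.arity (operator i)

  formula : (i : Fin size) → OperatorFormula (arity i)
  formula i = FunctionOperator.formula (operator i)

  field
    required : All (λ φ → ∃[ i ] (arity i , formula i) ≡ φ) requiredFormulas

------------------------------------------------------------------------
-- Derivations

module _ (𝓐 : AlgebraClass) where

  open AlgebraClass 𝓐

  data Derivation : Set where
    X⋆ : Derivation
    op : (i : Fin size) → Vec Derivation (arity i) → Derivation

  record Enumeration : Set where
    field
      numbering : Derivation ↔ ℕ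

    open Inverse numbering public using () renaming (to to index; from to derivation)

    field
      increasing : ∀ i (ds : Vec Derivation (arity i)) j →
                   index (lookup ds j) ℕ.< index (op i ds)

------------------------------------------------------------------------
-- The theories 𝓐RA₁ and 𝓐RA₂

module _ {𝓐 : AlgebraClass} (𝓔 : Enumeration 𝓐) where

  open AlgebraClass 𝓐
  open Enumeration 𝓔

  definition : Derivation 𝓐 → Formula arithmetical constants 0
  definition X⋆        = interpret (f (index X⋆) F.∷ X F.∷ F.[]) oracleFormula
  definition (op i ds) =
    interpret (f (index (op i ds)) F.∷ (λ j → f (index (lookup ds j)))) (formula i)

  data RA₁ : Theory arithmetical constants where
    basic    : ∀ {φ} → φ ∈ˡ BASIC → RA₁ φ
    defining : ∀ d → RA₁ (definition d)
    function : ∀ d → RA₁ (f (index d) ∈𝓕)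

module _ (𝓐 : AlgebraClass) where

  open AlgebraClass 𝓐

  data RA₂ : Theory second-order (vars 0) where
    basic         : ∀ {φ} → φ ∈ˡ BASIC → RA₂ φ
    operation     : ∀ i → RA₂ (closure₂ (arity i)
                      (⋀ (map _∈𝓕 (allFin (arity i))) ⇒
                       (∃₂ (zero ∈𝓕 ∧ interpret id (formula i)))))
    oracle        : RA₂ (∀₂ ∃₂ (zero ∈𝓕 ∧ interpret id oracleFormula))
    -- ∀p ∀f ∈ 𝓕 ∃X ∀x (x ∈ X ↔ f(x, p) = 1)
    comprehension : RA₂ (∀₁ ∀₂ (zero ∈𝓕 ⇒
                      (∃₂ ∀₁ (v₀ ∈ zero ⇔ suc zero ⟨ ⟨ v₀ , v₁ ⟩ ⟩≈ 𝟏))))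

------------------------------------------------------------------------
-- Lifting

-- The least k such that every f d occurring in φ has d < k.
rank : Formula arithmetical constants n → ℕ
rank φ = foldr _⊔_ 0 (map height (setSymbols φ))
  where
  height : Constant → ℕ
  height X     = 0
  height (f d) = suc d

-- The set variables of the prefix ∀X ∀f₀ … ∀f₍ₖ₋₁₎ standing for the constants.
-- Constants f d with d ≥ k are not bound by it; they do not occur where this
-- is used, and the value X given to them is arbitrary.
asVariable : ∀ k → Constant → Fin (suc k)
asVariable zero    _     = zero
asVariable (suc k) X     = suc (asVariable k X)
asVariable (suc k) (f d) with d ℕ.≟ k
... | yes _ = zero
... | no  _ = suc (asVariable k (f d))

module _ {𝓐 : AlgebraClass} (𝓔 : Enumeration 𝓐) where

  open Enumeration 𝓔

  Φ : ℕ → List (Formula arithmetical constants 0)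
  Φ k = concatMap (λ d → definition 𝓔 (derivation d) ∷ f d ∈𝓕 ∷ []) (upTo k)

  lifted : Formula arithmetical constants 0 → Formula second-order (vars 0) 0
  lifted φ = closure₂ (suc k) (interpret (asVariable k) (⋀ (Φ k) ⇒ φ))
    where k = rank φ

{-# OPTIONS --safe #-}

-- Reading the set constants as set variables turns derivations of L₁(X, f⃗)
-- into derivations of L₂.  A given proof of φ in 𝓐RA₁ uses only the axioms for
-- f₀, …, f₍N₋₁₎, for some N, so it becomes a proof in L₂ from Φ N and BASIC.
-- The assumptions on f_d for rank φ ≤ d < N are then discharged from the
-- last one downwards: the constants defining f_d are X or have smaller index,
-- so an axiom of 𝓐RA₂ yields a witness for the set variable f_d, which by then
-- occurs nowhere else.
module Submission where

open import Defs
open import Data.Fin using (Fin; zero; suc)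
import Data.Fin as Fin
open import Data.List using (List; []; _∷_; _++_; map; foldr; upTo; allFin)
open import Data.List.Membership.Propositional using () renaming (_∈_ to _∈ˡ_)
open import Data.List.Membership.Propositional.Properties
  using (∈-map⁺; ∈-map⁻; ∈-++⁺ˡ; ∈-++⁺ʳ; ∈-concatMap⁺; ∈-upTo⁺; ∈-upTo⁻; ∈-allFin)
open import Data.List.Properties using (map-∘; map-cong; map-id)
open import Data.List.Relation.Binary.Subset.Propositional using (_⊆_)
open import Data.List.Relation.Binary.Subset.Propositional.Properties
  using (∷⁺ʳ; map⁺)
open import Data.List.Relation.Unary.All using (All; []; _∷_; tabulate)
import Data.List.Relation.Unary.All as All
import Data.List.Relation.Unary.All.Properties as All
open import Data.List.Relation.Unary.Any using (here; there)
import Data.List.Relation.Unary.Any as Any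
open import Data.Nat using (ℕ; zero; suc; _⊔_; _≤′_; ≤′-reflexive; ≤′-step)
import Data.Nat as ℕ
import Data.Nat.Properties as ℕ
open import Data.Product using (∃-syntax; _,_)
open import Data.Sum using (inj₁; inj₂)
open import Data.Unit using (⊤; tt)
open import Data.Vec using (lookup)
import Data.Vec.Functional as F
open import Function using (_∘_; id; Inverse)
open import Relation.Binary.PropositionalEquality
  using (_≡_; _≗_; refl; sym; trans; cong; cong₂; subst; subst₂)
open import Relation.Nullary using (yes; no; contradiction)

private
  variable
    κ : Kind
    𝓢 𝓢′ 𝓢″ : SetScope
    n s s′ s″ : ℕ

-- Substitution and interpretation

lift-cong : {σ τ : Fin s → Fin s′} → σ ≗ τ → Fin.lift 1 σ ≗ Fin.lift 1 τ
lift-cong eq zero    = refl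
lift-cong eq (suc i) = cong suc (eq i)

lift-∘ : (σ : Fin s′ → Fin s″) (τ : Fin s → Fin s′) →
         Fin.lift 1 σ ∘ Fin.lift 1 τ ≗ Fin.lift 1 (σ ∘ τ)
lift-∘ σ τ zero    = refl
lift-∘ σ τ (suc i) = refl

lift-id : Fin.lift {s} 1 id ≗ id
lift-id zero    = refl
lift-id (suc i) = refl

sub₂-cong : {σ τ : Fin s → Fin s′} → σ ≗ τ →
            (φ : Formula second-order (vars s) n) → sub₂ σ φ ≡ sub₂ τ φ
sub₂-cong eq (t ≈ u) = refl
sub₂-cong eq (t < u) = refl
sub₂-cong eq (t ∈ Y) = cong (t ∈_) (eq Y)
sub₂-cong eq ⊥       = refl
sub₂-cong eq (φ ∧ ψ) = cong₂ _∧_ (sub₂-cong eq φ) (sub₂-cong eq ψ)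
sub₂-cong eq (φ ∨ ψ) = cong₂ _∨_ (sub₂-cong eq φ) (sub₂-cong eq ψ)
sub₂-cong eq (φ ⇒ ψ) = cong₂ _⇒_ (sub₂-cong eq φ) (sub₂-cong eq ψ)
sub₂-cong eq (∀₁ φ)  = cong ∀₁_ (sub₂-cong eq φ)
sub₂-cong eq (∃₁ φ)  = cong ∃₁_ (sub₂-cong eq φ)
sub₂-cong eq (∀₂ φ)  = cong ∀₂_ (sub₂-cong (lift-cong eq) φ)
sub₂-cong eq (∃₂ φ)  = cong ∃₂_ (sub₂-cong (lift-cong eq) φ)

sub₂-∘ : (σ : Fin s′ → Fin s″) (τ : Fin s → Fin s′)
         (φ : Formula second-order (vars s) n) → sub₂ σ (sub₂ τ φ) ≡ sub₂ (σ ∘ τ) φ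
sub₂-∘ σ τ (t ≈ u) = refl
sub₂-∘ σ τ (t < u) = refl
sub₂-∘ σ τ (t ∈ Y) = refl
sub₂-∘ σ τ ⊥       = refl
sub₂-∘ σ τ (φ ∧ ψ) = cong₂ _∧_ (sub₂-∘ σ τ φ) (sub₂-∘ σ τ ψ)
sub₂-∘ σ τ (φ ∨ ψ) = cong₂ _∨_ (sub₂-∘ σ τ φ) (sub₂-∘ σ τ ψ)
sub₂-∘ σ τ (φ ⇒ ψ) = cong₂ _⇒_ (sub₂-∘ σ τ φ) (sub₂-∘ σ τ ψ)
sub₂-∘ σ τ (∀₁ φ)  = cong ∀₁_ (sub₂-∘ σ τ φ)
sub₂-∘ σ τ (∃₁ φ)  = cong ∃₁_ (sub₂-∘ σ τ φ)
sub₂-∘ σ τ (∀₂ φ)  =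
  cong ∀₂_ (trans (sub₂-∘ (Fin.lift 1 σ) (Fin.lift 1 τ) φ) (sub₂-cong (lift-∘ σ τ) φ))
sub₂-∘ σ τ (∃₂ φ)  =
  cong ∃₂_ (trans (sub₂-∘ (Fin.lift 1 σ) (Fin.lift 1 τ) φ) (sub₂-cong (lift-∘ σ τ) φ))

sub₂-id : (φ : Formula second-order (vars s) n) → sub₂ id φ ≡ φ
sub₂-id (t ≈ u) = refl
sub₂-id (t < u) = refl
sub₂-id (t ∈ Y) = refl
sub₂-id ⊥       = refl
sub₂-id (φ ∧ ψ) = cong₂ _∧_ (sub₂-id φ) (sub₂-id ψ)
sub₂-id (φ ∨ ψ) = cong₂ _∨_ (sub₂-id φ) (sub₂-id ψ)
sub₂-id (φ ⇒ ψ) = cong₂ _⇒_ (sub₂-id φ) (sub₂-id ψ)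
sub₂-id (∀₁ φ)  = cong ∀₁_ (sub₂-id φ)
sub₂-id (∃₁ φ)  = cong ∃₁_ (sub₂-id φ)
sub₂-id (∀₂ φ)  = cong ∀₂_ (trans (sub₂-cong lift-id φ) (sub₂-id φ))
sub₂-id (∃₂ φ)  = cong ∃₂_ (trans (sub₂-cong lift-id φ) (sub₂-id φ))

interpret-cong : {σ τ : SetSymbol 𝓢 → SetSymbol 𝓢′} (φ : Formula arithmetical 𝓢 n) →
                 (∀ {Y} → Y ∈ˡ setSymbols φ → σ Y ≡ τ Y) →
                 interpret {𝓢} {𝓢′} {κ = κ} σ φ ≡ interpret τ φ
interpret-cong (t ≈ u) eq = refl
interpret-cong (t < u) eq = refl
interpret-cong (t ∈ Y) eq = cong (t ∈_) (eq (here refl))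
interpret-cong ⊥       eq = refl
interpret-cong {𝓢} {𝓢′} (φ ∧ ψ) eq =
  cong₂ _∧_ (interpret-cong {𝓢} {𝓢′} φ (eq ∘ ∈-++⁺ˡ))
            (interpret-cong {𝓢} {𝓢′} ψ (eq ∘ ∈-++⁺ʳ (setSymbols φ)))
interpret-cong {𝓢} {𝓢′} (φ ∨ ψ) eq =
  cong₂ _∨_ (interpret-cong {𝓢} {𝓢′} φ (eq ∘ ∈-++⁺ˡ))
            (interpret-cong {𝓢} {𝓢′} ψ (eq ∘ ∈-++⁺ʳ (setSymbols φ)))
interpret-cong {𝓢} {𝓢′} (φ ⇒ ψ) eq =
  cong₂ _⇒_ (interpret-cong {𝓢} {𝓢′} φ (eq ∘ ∈-++⁺ˡ))
            (interpret-cong {𝓢} {𝓢′} ψ (eq ∘ ∈-++⁺ʳ (setSymbols φ)))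
interpret-cong {𝓢} {𝓢′} (∀₁ φ) eq = cong ∀₁_ (interpret-cong {𝓢} {𝓢′} φ eq)
interpret-cong {𝓢} {𝓢′} (∃₁ φ) eq = cong ∃₁_ (interpret-cong {𝓢} {𝓢′} φ eq)

interpret-∘ : (σ : SetSymbol 𝓢′ → SetSymbol 𝓢″) (τ : SetSymbol 𝓢 → SetSymbol 𝓢′)
              (φ : Formula arithmetical 𝓢 n) →
              interpret {𝓢′} {𝓢″} {κ = κ} σ (interpret {𝓢} τ φ) ≡ interpret (σ ∘ τ) φ
interpret-∘ σ τ (t ≈ u) = refl
interpret-∘ σ τ (t < u) = refl
interpret-∘ σ τ (t ∈ Y) = refl
interpret-∘ σ τ ⊥       = refl
interpret-∘ {𝓢′} {𝓢″} {𝓢} σ τ (φ ∧ ψ) =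
  cong₂ _∧_ (interpret-∘ {𝓢′} {𝓢″} {𝓢} σ τ φ) (interpret-∘ {𝓢′} {𝓢″} {𝓢} σ τ ψ)
interpret-∘ {𝓢′} {𝓢″} {𝓢} σ τ (φ ∨ ψ) =
  cong₂ _∨_ (interpret-∘ {𝓢′} {𝓢″} {𝓢} σ τ φ) (interpret-∘ {𝓢′} {𝓢″} {𝓢} σ τ ψ)
interpret-∘ {𝓢′} {𝓢″} {𝓢} σ τ (φ ⇒ ψ) =
  cong₂ _⇒_ (interpret-∘ {𝓢′} {𝓢″} {𝓢} σ τ φ) (interpret-∘ {𝓢′} {𝓢″} {𝓢} σ τ ψ)
interpret-∘ {𝓢′} {𝓢″} {𝓢} σ τ (∀₁ φ) = cong ∀₁_ (interpret-∘ {𝓢′} {𝓢″} {𝓢} σ τ φ)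
interpret-∘ {𝓢′} {𝓢″} {𝓢} σ τ (∃₁ φ) = cong ∃₁_ (interpret-∘ {𝓢′} {𝓢″} {𝓢} σ τ φ)

sub₂-interpret : (σ : Fin s → Fin s′) (τ : SetSymbol 𝓢 → Fin s)
                 (φ : Formula arithmetical 𝓢 n) →
                 sub₂ σ (interpret {𝓢} τ φ) ≡ interpret (σ ∘ τ) φ
sub₂-interpret σ τ (t ≈ u) = refl
sub₂-interpret σ τ (t < u) = refl
sub₂-interpret σ τ (t ∈ Y) = refl
sub₂-interpret σ τ ⊥       = refl
sub₂-interpret {𝓢 = 𝓢} σ τ (φ ∧ ψ) =
  cong₂ _∧_ (sub₂-interpret {𝓢 = 𝓢} σ τ φ) (sub₂-interpret {𝓢 = 𝓢} σ τ ψ)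
sub₂-interpret {𝓢 = 𝓢} σ τ (φ ∨ ψ) =
  cong₂ _∨_ (sub₂-interpret {𝓢 = 𝓢} σ τ φ) (sub₂-interpret {𝓢 = 𝓢} σ τ ψ)
sub₂-interpret {𝓢 = 𝓢} σ τ (φ ⇒ ψ) =
  cong₂ _⇒_ (sub₂-interpret {𝓢 = 𝓢} σ τ φ) (sub₂-interpret {𝓢 = 𝓢} σ τ ψ)
sub₂-interpret {𝓢 = 𝓢} σ τ (∀₁ φ) = cong ∀₁_ (sub₂-interpret {𝓢 = 𝓢} σ τ φ)
sub₂-interpret {𝓢 = 𝓢} σ τ (∃₁ φ) = cong ∃₁_ (sub₂-interpret {𝓢 = 𝓢} σ τ φ)

setSymbols-interpret : (τ : SetSymbol 𝓢 → SetSymbol 𝓢′) (φ : Formula arithmetical 𝓢 n)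
                       {P : SetSymbol 𝓢′ → Set} → (∀ Y → P (τ Y)) →
                       All P (setSymbols (interpret {𝓢} {𝓢′} τ φ))
setSymbols-interpret τ (t ≈ u) p = []
setSymbols-interpret τ (t < u) p = []
setSymbols-interpret τ (t ∈ Y) p = p Y ∷ []
setSymbols-interpret τ ⊥       p = []
setSymbols-interpret {𝓢} {𝓢′} τ (φ ∧ ψ) p =
  All.++⁺ (setSymbols-interpret {𝓢} {𝓢′} τ φ p) (setSymbols-interpret {𝓢} {𝓢′} τ ψ p)
setSymbols-interpret {𝓢} {𝓢′} τ (φ ∨ ψ) p =
  All.++⁺ (setSymbols-interpret {𝓢} {𝓢′} τ φ p) (setSymbols-interpret {𝓢} {𝓢′} τ ψ p)
setSymbols-interpret {𝓢} {𝓢′} τ (φ ⇒ ψ) p =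
  All.++⁺ (setSymbols-interpret {𝓢} {𝓢′} τ φ p) (setSymbols-interpret {𝓢} {𝓢′} τ ψ p)
setSymbols-interpret {𝓢} {𝓢′} τ (∀₁ φ) p = setSymbols-interpret {𝓢} {𝓢′} τ φ p
setSymbols-interpret {𝓢} {𝓢′} τ (∃₁ φ) p = setSymbols-interpret {𝓢} {𝓢′} τ φ p

-- Derivations

weaken : {Γ Δ : List (Formula κ 𝓢 n)} {φ : Formula κ 𝓢 n} → Γ ⊆ Δ → Γ ⊢ φ → Δ ⊢ φ
weaken Γ⊆Δ (hyp φ∈Γ)      = hyp (Γ⊆Δ φ∈Γ)
weaken Γ⊆Δ (raa p)        = raa (weaken (∷⁺ʳ _ Γ⊆Δ) p)
weaken Γ⊆Δ (⇒I p)         = ⇒I (weaken (∷⁺ʳ _ Γ⊆Δ) p)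
weaken Γ⊆Δ (⇒E p q)       = ⇒E (weaken Γ⊆Δ p) (weaken Γ⊆Δ q)
weaken Γ⊆Δ (∧I p q)       = ∧I (weaken Γ⊆Δ p) (weaken Γ⊆Δ q)
weaken Γ⊆Δ (∧E₁ p)        = ∧E₁ (weaken Γ⊆Δ p)
weaken Γ⊆Δ (∧E₂ p)        = ∧E₂ (weaken Γ⊆Δ p)
weaken Γ⊆Δ (∨I₁ p)        = ∨I₁ (weaken Γ⊆Δ p)
weaken Γ⊆Δ (∨I₂ p)        = ∨I₂ (weaken Γ⊆Δ p)
weaken Γ⊆Δ (∨E p q r)     =
  ∨E (weaken Γ⊆Δ p) (weaken (∷⁺ʳ _ Γ⊆Δ) q) (weaken (∷⁺ʳ _ Γ⊆Δ) r)
weaken Γ⊆Δ (≈I t)         = ≈I t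
weaken Γ⊆Δ (≈E φ p q)     = ≈E φ (weaken Γ⊆Δ p) (weaken Γ⊆Δ q)
weaken Γ⊆Δ (∀₁I p)        = ∀₁I (weaken (map⁺ wk₁ Γ⊆Δ) p)
weaken Γ⊆Δ (∀₁E p t)      = ∀₁E (weaken Γ⊆Δ p) t
weaken Γ⊆Δ (∃₁I φ t p)    = ∃₁I φ t (weaken Γ⊆Δ p)
weaken Γ⊆Δ (∃₁E p q)      = ∃₁E (weaken Γ⊆Δ p) (weaken (∷⁺ʳ _ (map⁺ wk₁ Γ⊆Δ)) q)
weaken Γ⊆Δ (∀₂I p)        = ∀₂I (weaken (map⁺ wk₂ Γ⊆Δ) p)
weaken Γ⊆Δ (∀₂E p Y)      = ∀₂E (weaken Γ⊆Δ p) Y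
weaken Γ⊆Δ (∃₂I φ Y p)    = ∃₂I φ Y (weaken Γ⊆Δ p)
weaken Γ⊆Δ (∃₂E p q)      = ∃₂E (weaken Γ⊆Δ p) (weaken (∷⁺ʳ _ (map⁺ wk₂ Γ⊆Δ)) q)
weaken Γ⊆Δ (inhabited₂ p) = inhabited₂ (weaken (map⁺ wk₂ Γ⊆Δ) p)

cut : {Γ Δ : List (Formula κ 𝓢 n)} {φ : Formula κ 𝓢 n} → All (Δ ⊢_) Γ → Γ ⊢ φ → Δ ⊢ φ
cut []       q = weaken (λ ()) q
cut (p ∷ ps) q = ⇒E (cut ps (⇒I q)) p

module _ {𝓢 𝓢′ : SetScope} (τ : SetSymbol 𝓢 → SetSymbol 𝓢′) {κ : Kind} where

  private
    ⟪_⟫ : Formula arithmetical 𝓢 n → Formula κ 𝓢′ n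
    ⟪_⟫ = interpret {𝓢} {𝓢′} τ

  interpret-sub₁ : ∀ {m n} (σ : Fin m → Term n) (φ : Formula arithmetical 𝓢 m) →
                   ⟪ sub₁ σ φ ⟫ ≡ sub₁ σ ⟪ φ ⟫
  interpret-sub₁ σ (t ≈ u) = refl
  interpret-sub₁ σ (t < u) = refl
  interpret-sub₁ σ (t ∈ Y) = refl
  interpret-sub₁ σ ⊥       = refl
  interpret-sub₁ σ (φ ∧ ψ) = cong₂ _∧_ (interpret-sub₁ σ φ) (interpret-sub₁ σ ψ)
  interpret-sub₁ σ (φ ∨ ψ) = cong₂ _∨_ (interpret-sub₁ σ φ) (interpret-sub₁ σ ψ)
  interpret-sub₁ σ (φ ⇒ ψ) = cong₂ _⇒_ (interpret-sub₁ σ φ) (interpret-sub₁ σ ψ)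
  interpret-sub₁ σ (∀₁ φ)  = cong ∀₁_ (interpret-sub₁ (lift₁ σ) φ)
  interpret-sub₁ σ (∃₁ φ)  = cong ∃₁_ (interpret-sub₁ (lift₁ σ) φ)

  map-interpret-wk₁ : (Γ : List (Formula arithmetical 𝓢 n)) →
                      map ⟪_⟫ (map wk₁ Γ) ≡ map wk₁ (map ⟪_⟫ Γ)
  map-interpret-wk₁ Γ =
    trans (sym (map-∘ Γ)) (trans (map-cong (interpret-sub₁ _) Γ) (map-∘ Γ))

  interpret-⊢ : {Γ : List (Formula arithmetical 𝓢 n)} {φ : Formula arithmetical 𝓢 n} →
                Γ ⊢ φ → map ⟪_⟫ Γ ⊢ ⟪ φ ⟫
  interpret-⊢ (hyp φ∈Γ)  = hyp (∈-map⁺ ⟪_⟫ φ∈Γ)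
  interpret-⊢ (raa p)    = raa (interpret-⊢ p)
  interpret-⊢ (⇒I p)     = ⇒I (interpret-⊢ p)
  interpret-⊢ (⇒E p q)   = ⇒E (interpret-⊢ p) (interpret-⊢ q)
  interpret-⊢ (∧I p q)   = ∧I (interpret-⊢ p) (interpret-⊢ q)
  interpret-⊢ (∧E₁ p)    = ∧E₁ (interpret-⊢ p)
  interpret-⊢ (∧E₂ p)    = ∧E₂ (interpret-⊢ p)
  interpret-⊢ (∨I₁ p)    = ∨I₁ (interpret-⊢ p)
  interpret-⊢ (∨I₂ p)    = ∨I₂ (interpret-⊢ p)
  interpret-⊢ (∨E p q r) = ∨E (interpret-⊢ p) (interpret-⊢ q) (interpret-⊢ r)
  interpret-⊢ (≈I t)     = ≈I t
  interpret-⊢ (≈E φ p q) =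
    subst (_ ⊢_) (sym (interpret-sub₁ _ φ))
      (≈E ⟪ φ ⟫ (interpret-⊢ p) (subst (_ ⊢_) (interpret-sub₁ _ φ) (interpret-⊢ q)))
  interpret-⊢ {Γ = Γ} (∀₁I p) =
    ∀₁I (subst (_⊢ _) (map-interpret-wk₁ Γ) (interpret-⊢ p))
  interpret-⊢ (∀₁E {φ = φ} p t) =
    subst (_ ⊢_) (sym (interpret-sub₁ _ φ)) (∀₁E (interpret-⊢ p) t)
  interpret-⊢ (∃₁I φ t p) =
    ∃₁I ⟪ φ ⟫ t (subst (_ ⊢_) (interpret-sub₁ _ φ) (interpret-⊢ p))
  interpret-⊢ {Γ = Γ} (∃₁E {φ = φ} {ψ} p q) =
    ∃₁E (interpret-⊢ p)
      (subst₂ (λ Δ χ → ⟪ φ ⟫ ∷ Δ ⊢ χ) (map-interpret-wk₁ Γ) (interpret-sub₁ _ ψ)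
        (interpret-⊢ q))

⋀I : {Δ Γ : List (Formula κ 𝓢 n)} → All (Δ ⊢_) Γ → Δ ⊢ ⋀ Γ
⋀I []       = ⇒I (hyp (here refl))
⋀I (p ∷ ps) = ∧I p (⋀I ps)

interpret-⋀E : (τ : SetSymbol 𝓢 → SetSymbol 𝓢′) {Δ : List (Formula κ 𝓢′ n)}
               {Γ : List (Formula arithmetical 𝓢 n)} {φ : Formula arithmetical 𝓢 n} →
               φ ∈ˡ Γ → Δ ⊢ interpret τ (⋀ Γ) → Δ ⊢ interpret τ φ
interpret-⋀E τ (here refl) p = ∧E₁ p
interpret-⋀E {𝓢} {𝓢′} τ (there φ∈Γ) p = interpret-⋀E {𝓢} {𝓢′} τ φ∈Γ (∧E₂ p)

closure₂E : {Δ : List (Formula second-order (vars s′) n)}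
            (φ : Formula second-order (vars s) n) (σ : Fin s → Fin s′) →
            Δ ⊢ sub₂ (λ ()) (closure₂ s φ) → Δ ⊢ sub₂ σ φ
closure₂E {s = zero}  φ σ p = subst (_ ⊢_) (sub₂-cong (λ ()) φ) p
closure₂E {s = suc s} φ σ p =
  subst (_ ⊢_) (trans (sub₂-∘ _ _ φ) (sub₂-cong pointwise φ))
    (∀₂E (closure₂E (∀₂ φ) (σ ∘ suc) p) (σ zero))
  where
  pointwise : (σ zero F.∷ id) ∘ Fin.lift 1 (σ ∘ suc) ≗ σ
  pointwise zero    = refl
  pointwise (suc i) = refl

closed : Formula second-order (vars 0) n → Formula second-order (vars s) n
closed = sub₂ (λ ())

wk₂-closed : (φ : Formula second-order (vars 0) n) → wk₂ (closed {s = s} φ) ≡ closed φ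
wk₂-closed φ = trans (sub₂-∘ _ _ φ) (sub₂-cong (λ ()) φ)

closure₂I : (Γ : List (Formula second-order (vars 0) n)) (s : ℕ)
            {φ : Formula second-order (vars s) n} →
            map closed Γ ⊢ φ → Γ ⊢ closure₂ s φ
closure₂I Γ zero    p =
  subst (_⊢ _) (trans (map-cong (λ φ → trans (sub₂-cong (λ ()) φ) (sub₂-id φ)) Γ) (map-id Γ)) p
closure₂I Γ (suc s) p =
  closure₂I Γ s (∀₂I (subst (_⊢ _) (trans (map-cong (sym ∘ wk₂-closed) Γ) (map-∘ Γ)) p))

-- Set constants as set variables

_below_ : Constant → ℕ → Set
X   below k = ⊤
f d below k = d ℕ.< k

≤-foldr-⊔ : {A : Set} (h : A → ℕ) {x : A} {xs : List A} → x ∈ˡ xs →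
            h x ℕ.≤ foldr _⊔_ 0 (map h xs)
≤-foldr-⊔ h (here refl)  = ℕ.m≤m⊔n _ _
≤-foldr-⊔ h (there x∈xs) = ℕ.≤-trans (≤-foldr-⊔ h x∈xs) (ℕ.m≤n⊔m _ _)

below-rank : (φ : Formula arithmetical constants n) {c : Constant} →
             c ∈ˡ setSymbols φ → c below rank φ
below-rank φ {X}   c∈φ = tt
below-rank φ {f d} c∈φ = ≤-foldr-⊔ _ c∈φ

below-≤ : ∀ {c m} → m ℕ.≤ n → c below m → c below n
below-≤ {c = X}   m≤n _   = tt
below-≤ {c = f d} m≤n d<m = ℕ.<-≤-trans d<m m≤n

asVariable-new : ∀ k → asVariable (suc k) (f k) ≡ zero
asVariable-new k with k ℕ.≟ k
... | yes _  = refl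
... | no k≢k = contradiction refl k≢k

asVariable-old : ∀ {k c} → c below k → asVariable (suc k) c ≡ suc (asVariable k c)
asVariable-old {c = X}   _ = refl
asVariable-old {k} {f d} d<k with d ℕ.≟ k
... | yes d≡k = contradiction d≡k (ℕ.<⇒≢ d<k)
... | no  _   = refl

⟪_⟫ : ∀ {k} → Formula arithmetical constants n → Formula second-order (vars (suc k)) n
⟪_⟫ {k = k} = interpret (asVariable k)

wk₂-⟪⟫ : ∀ {k} (φ : Formula arithmetical constants n) → All (_below k) (setSymbols φ) →
         wk₂ (⟪_⟫ {k = k} φ) ≡ ⟪ φ ⟫
wk₂-⟪⟫ {k = k} φ φ<k =
  trans (sub₂-interpret suc (asVariable k) φ)
        (interpret-cong {constants} {vars _} φ (sym ∘ asVariable-old ∘ All.lookup φ<k))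

module _ (𝓐 : AlgebraClass) where

  open AlgebraClass 𝓐

  operationBody : ∀ i → Formula second-order (vars (arity i)) 0
  operationBody i =
    ⋀ (map _∈𝓕 (allFin (arity i))) ⇒ (∃₂ (zero ∈𝓕 ∧ interpret id (formula i)))

  oracleBody : Formula second-order (vars 1) 0
  oracleBody = ∃₂ (zero ∈𝓕 ∧ interpret id oracleFormula)

  existenceAxioms : List (Formula second-order (vars 0) 0)
  existenceAxioms =
    closure₂ 1 oracleBody ∷ map (λ i → closure₂ (arity i) (operationBody i)) (allFin size)

  axioms : List (Formula second-order (vars 0) 0)
  axioms = BASIC ++ existenceAxioms

  axioms-RA₂ : All (RA₂ 𝓐) axioms
  axioms-RA₂ =
    All.++⁺ (tabulate basic) (oracle ∷ All.map⁺ (All.universal operation (allFin size)))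

module _ {𝓐 : AlgebraClass} (𝓔 : Enumeration 𝓐) where

  open AlgebraClass 𝓐
  open Enumeration 𝓔

  characterization : ℕ → Formula arithmetical constants 0
  characterization d = f d ∈𝓕 ∧ definition 𝓔 (derivation d)

  record Supports (k : ℕ) (Δ : List (Formula second-order (vars (suc k)) 0)) : Set where
    field
      axiom         : map closed (axioms 𝓐) ⊆ Δ
      characterized : ∀ {d} → d ℕ.< k → ⟪ characterization d ⟫ ∈ˡ Δ

  open Supports

  Entails : ℕ → Formula arithmetical constants 0 → Set
  Entails k φ = ∀ {Δ} → Supports k Δ → Δ ⊢ ⟪ φ ⟫

  derivation-index : ∀ d → derivation (index d) ≡ d
  derivation-index = Inverse.strictlyInverseʳ numbering

  index-derivation : ∀ k → index (derivation k) ≡ k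
  index-derivation = Inverse.strictlyInverseˡ numbering

  basic-Entails : ∀ {k φ} → φ ∈ˡ BASIC → Entails k φ
  basic-Entails {k} φ∈BASIC sup =
    hyp (axiom sup (∈-++⁺ˡ {xs = map closed BASIC} (∈-map⁺ ⟪_⟫ φ∈BASIC)))

  characterization-Entails : ∀ {k} d → index d ℕ.< k →
                             Entails k (f (index d) ∈𝓕 ∧ definition 𝓔 d)
  characterization-Entails d d<k sup =
    hyp (subst (λ e → ⟪ f (index d) ∈𝓕 ∧ definition 𝓔 e ⟫ ∈ˡ _) (derivation-index d)
      (characterized sup d<k))

  axiom-Entails : ∀ {φ} → RA₁ 𝓔 φ → ∃[ N ] (∀ {k} → N ℕ.≤ k → Entails k φ)
  axiom-Entails (basic φ∈BASIC) = 0 , λ _ → basic-Entails φ∈BASIC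
  axiom-Entails (defining d) =
    suc (index d) , λ d<k sup → ∧E₂ (characterization-Entails d d<k sup)
  axiom-Entails (function d) =
    suc (index d) , λ d<k sup → ∧E₁ (characterization-Entails d d<k sup)

  axioms-Entails : ∀ {Γ} → All (RA₁ 𝓔) Γ → ∃[ N ] (∀ {k} → N ℕ.≤ k → All (Entails k) Γ)
  axioms-Entails []       = 0 , λ _ → []
  axioms-Entails (γ ∷ Γ) with axiom-Entails γ | axioms-Entails Γ
  ... | M , p | N , ps =
    M ⊔ N , λ le → p (ℕ.≤-trans (ℕ.m≤m⊔n M N) le) ∷ ps (ℕ.≤-trans (ℕ.m≤n⊔m M N) le)

  ⊢-Entails : ∀ {Γ φ k} → Γ ⊢ φ → All (Entails k) Γ → Entails k φ
  ⊢-Entails {k = k} p ps sup =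
    cut (All.map⁺ (All.map (λ q → q sup) ps)) (interpret-⊢ {constants} (asVariable k) p)

  definingArity : Derivation 𝓐 → ℕ
  definingArity X⋆       = 1
  definingArity (op i _) = arity i

  definingFormula : ∀ d → OperatorFormula (definingArity d)
  definingFormula X⋆       = oracleFormula
  definingFormula (op i _) = formula i

  arguments : ∀ d → Fin (definingArity d) → Constant
  arguments X⋆        = X F.∷ F.[]
  arguments (op i ds) = λ j → f (index (lookup ds j))

  definition-interpret : ∀ d → definition 𝓔 d ≡
    interpret {vars _} {constants} (f (index d) F.∷ arguments d) (definingFormula d)
  definition-interpret X⋆        = refl
  definition-interpret (op i ds) = refl

  arguments-below : ∀ d j → arguments d j below index d
  arguments-below X⋆        zero = tt
  arguments-below (op i ds) j    = increasing i ds j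

  characterization-below : ∀ d → All (_below suc d) (setSymbols (characterization d))
  characterization-below d =
    d<1+d ∷ d<1+d ∷ d<1+d ∷ d<1+d ∷
      subst (All _ ∘ setSymbols) (sym (definition-interpret (derivation d)))
        (setSymbols-interpret {vars _} {constants} _ (definingFormula (derivation d)) symbol<)
    where
    d<1+d : d ℕ.< suc d
    d<1+d = ℕ.n<1+n d

    symbol< : ∀ Y → (f (index (derivation d)) F.∷ arguments (derivation d)) Y below suc d
    symbol< zero    = ℕ.≤-reflexive (cong suc (index-derivation d))
    symbol< (suc j) =
      below-≤ (ℕ.m≤n⇒m≤1+n (ℕ.≤-reflexive (index-derivation d)))
        (arguments-below (derivation d) j)

  sub₂-body : ∀ {a s} (σ : Fin a → Fin s) (φ : OperatorFormula a) →
    sub₂ σ (∃₂ (zero ∈𝓕 ∧ interpret id φ)) ≡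
    (∃₂ (zero ∈𝓕 ∧ interpret {vars _} {vars _} (Fin.lift 1 σ) φ))
  sub₂-body σ φ = cong (λ ψ → ∃₂ (zero ∈𝓕 ∧ ψ)) (sub₂-interpret (Fin.lift 1 σ) id φ)

  existenceAxiomE : ∀ {a k Δ} (ψ : Formula second-order (vars a) 0) →
    closure₂ a ψ ∈ˡ existenceAxioms 𝓐 → (σ : Fin a → Fin (suc k)) →
    Supports k Δ → Δ ⊢ sub₂ σ ψ
  existenceAxiomE ψ ψ∈ σ sup =
    closure₂E ψ σ (hyp (axiom sup (∈-map⁺ closed (∈-++⁺ʳ BASIC ψ∈))))

  existence-⊢ : ∀ d {Δ} → Supports (index d) Δ →
    Δ ⊢ (∃₂ (zero ∈𝓕 ∧
      interpret {vars _} {vars _} (Fin.lift 1 (asVariable (index d) ∘ arguments d))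
        (definingFormula d)))
  existence-⊢ X⋆ {Δ} sup =
    subst (Δ ⊢_) (sub₂-body σ oracleFormula) (existenceAxiomE (oracleBody 𝓐) (here refl) σ sup)
    where
    σ : Fin 1 → Fin (suc (index X⋆))
    σ = asVariable (index X⋆) ∘ arguments X⋆
  existence-⊢ (op i ds) {Δ} sup =
    subst (Δ ⊢_) (sub₂-body σ (formula i))
      (⇒E (existenceAxiomE (operationBody 𝓐 i) (there (∈-map⁺ _ (∈-allFin i))) σ sup)
          (guard (allFin (arity i))))
    where
    σ : Fin (arity i) → Fin (suc (index (op i ds)))
    σ = asVariable (index (op i ds)) ∘ arguments (op i ds)

    guard : ∀ js → Δ ⊢ sub₂ σ (⋀ (map _∈𝓕 js))
    guard []       = ⇒I (hyp (here refl))
    guard (j ∷ js) =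
      ∧I (∧E₁ (characterization-Entails (lookup ds j) (increasing i ds j) sup)) (guard js)

  new-characterization : ∀ d →
    ⟪_⟫ {k = suc (index d)} (characterization (index d)) ≡
    (zero ∈𝓕 ∧
      interpret {vars _} {vars _} (Fin.lift 1 (asVariable (index d) ∘ arguments d))
        (definingFormula d))
  new-characterization d =
    cong₂ _∧_
      (cong _∈𝓕 (asVariable-new (index d)))
      (trans (cong ⟪_⟫ (trans (cong (definition 𝓔) (derivation-index d)) (definition-interpret d)))
        (trans (interpret-∘ {constants} {vars _} {vars _} _ _ (definingFormula d))
          (interpret-cong {vars _} {vars _} (definingFormula d) (λ {Y} _ → pointwise Y))))
    where
    pointwise : ∀ Y → asVariable (suc (index d)) ((f (index d) F.∷ arguments d) Y) ≡
                      Fin.lift 1 (asVariable (index d) ∘ arguments d) Y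
    pointwise zero    = asVariable-new (index d)
    pointwise (suc j) = asVariable-old (arguments-below d j)

  ∃-characterization : ∀ k {Δ} → Supports k Δ → Δ ⊢ (∃₂ ⟪_⟫ {k = suc k} (characterization k))
  ∃-characterization k = subst P (index-derivation k) λ {Δ} sup →
    subst (λ ψ → Δ ⊢ (∃₂ ψ)) (sym (new-characterization (derivation k)))
      (existence-⊢ (derivation k) sup)
    where
    P : ℕ → Set
    P k = ∀ {Δ} → Supports k Δ → Δ ⊢ (∃₂ ⟪_⟫ {k = suc k} (characterization k))

  Supports-suc : ∀ {k Δ} → Supports k Δ → Supports (suc k) (⟪ characterization k ⟫ ∷ map wk₂ Δ)
  Supports-suc {k} {Δ} sup .axiom {ψ} ψ∈ with ∈-map⁻ closed {xs = axioms 𝓐} ψ∈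
  ... | χ , χ∈ , refl =
    there (subst (_∈ˡ map wk₂ Δ) (wk₂-closed {s = suc k} χ)
      (∈-map⁺ wk₂ (axiom sup (∈-map⁺ closed {xs = axioms 𝓐} χ∈))))
  Supports-suc {k} {Δ} sup .characterized {d} d<1+k with ℕ.m≤n⇒m<n∨m≡n (ℕ.s≤s⁻¹ d<1+k)
  ... | inj₂ refl = here refl
  ... | inj₁ d<k  =
    there (subst (_∈ˡ map wk₂ Δ)
      (wk₂-⟪⟫ (characterization d)
        (All.map (λ {c} → below-≤ {c = c} d<k) (characterization-below d)))
      (∈-map⁺ wk₂ (characterized sup d<k)))

  Entails-pred : ∀ {k φ} → rank φ ℕ.≤ k → Entails (suc k) φ → Entails k φ
  Entails-pred {k} {φ} φ≤k e sup =
    ∃₂E (∃-characterization k sup)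
      (subst (_ ⊢_)
        (sym (wk₂-⟪⟫ φ (tabulate λ {c} c∈φ → below-≤ {c = c} φ≤k (below-rank φ c∈φ))))
        (e (Supports-suc sup)))

  Entails-rank : ∀ {N φ} → rank φ ≤′ N → Entails N φ → Entails (rank φ) φ
  Entails-rank (≤′-reflexive refl) e = e
  Entails-rank {φ = φ} (≤′-step le) e =
    Entails-rank le (Entails-pred {φ = φ} (ℕ.≤′⇒≤ le) e)

  Φ-characterization : ∀ {k Δ d} → d ℕ.< k → Δ ⊢ ⟪_⟫ {k = k} (⋀ (Φ 𝓔 k)) →
                       Δ ⊢ ⟪_⟫ {k = k} (characterization d)
  Φ-characterization {k} {d = d} d<k p =
    ∧I (⋀E (there (here refl))) (⋀E (here refl))
    where
    ⋀E : ∀ {ψ} → ψ ∈ˡ definition 𝓔 (derivation d) ∷ f d ∈𝓕 ∷ [] → _ ⊢ ⟪ ψ ⟫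
    ⋀E ψ∈ = interpret-⋀E {constants} {vars _} (asVariable k)
      (∈-concatMap⁺ _ (Any.map (λ { refl → ψ∈ }) (∈-upTo⁺ d<k))) p

  Entails-lifted : ∀ {φ} → Entails (rank φ) φ → axioms 𝓐 ⊢ lifted 𝓔 φ
  Entails-lifted {φ} e =
    closure₂I (axioms 𝓐) (suc k) (⇒I (cut derivable (e supported)))
    where
    k = rank φ

    characterizations : List (Formula second-order (vars (suc k)) 0)
    characterizations = map (⟪_⟫ ∘ characterization) (upTo k)

    supported : Supports k (characterizations ++ map closed (axioms 𝓐))
    supported .axiom             = ∈-++⁺ʳ characterizations
    supported .characterized d<k = ∈-++⁺ˡ (∈-map⁺ _ (∈-upTo⁺ d<k))

    derivable : All (⟪ ⋀ (Φ 𝓔 k) ⟫ ∷ map closed (axioms 𝓐) ⊢_)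
                    (characterizations ++ map closed (axioms 𝓐))
    derivable = All.++⁺
      (All.map⁺ (tabulate λ d∈ → Φ-characterization (∈-upTo⁻ d∈) (hyp (here refl))))
      (tabulate (hyp ∘ there))

theorem9p5 : (𝓐 : AlgebraClass) (𝓔 : Enumeration 𝓐) (φ : Formula arithmetical constants 0) → RA₁ 𝓔 ⊩ φ → RA₂ 𝓐 ⊩ lifted 𝓔 φ
theorem9p5 𝓐 𝓔 φ (Γ , Γ-RA₁ , p) with axioms-Entails 𝓔 Γ-RA₁
... | N , Γ-entailed =
  axioms 𝓐 , axioms-RA₂ 𝓐 , Entails-lifted 𝓔 {φ}
    (Entails-rank 𝓔 {N ⊔ rank φ} {φ} (ℕ.≤⇒≤′ (ℕ.m≤n⊔m N (rank φ)))
      (⊢-Entails 𝓔 p (Γ-entailed (ℕ.m≤m⊔n N (rank φ)))))
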